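{- For all integers $n\ge1$ and $h\ge k\ge 1$, the ordered tree $U^k_{\lfloor\lg n\rfloor,h}$ is $k$-Strahler $(n,h)$-universal.
   Context: $\lg$ is the base-2 logarithm. Ordered trees: the trivial tree $\langle\rangle$ (a single node, which is a leaf) is an ordered tree, and so is a sequence $\langle T_1,\dots,T_\ell\rangle$ ($\ell\ge1$) of ordered trees (a root whose children are the roots of $T_1,\dots,T_\ell$). The number of leaves is $1$ for the trivial tree and the sum of the numbers of leaves of the $T_i$ otherwise; the height is $1$ for the trivial tree and $1+\max_i\mathrm{height}(T_i)$ otherwise. A tree is $(n,h)$-small if it has at most $n$ leaves and height at most $h$. The Strahler number is defined by $\mathrm{Str}(\langle\rangle)=1$ and, for $T=\langle T_1,\dots,T_\ell\rangle$ with $m=\max_i\mathrm{Str}(T_i)$, $\mathrm{Str}(T)=m$ if there is a unique $i$ with $\mathrm{Str}(T_i)=m$, and $\mathrm{Str}(T)=m+1$ otherwise. The symbol $\cdot$ between trees denotes concatenation of sequences (merging roots). The trivial tree can be embedded in every ordered tree; $\langle T_1,\dots,T_a\rangle$ can be embedded in $\langle T'_1,\dots,T'_b\rangle$ if there are $1\le i_1<\dots<i_a\le b$ such that each $T_j$ can be embedded in $T'_{i_j}$. A tree is $k$-Strahler $(n,h)$-universal if every $(n,h)$-small ordered tree of Strahler number at most $k$ can be embedded in it. For all $t\ge 0$, the trees $U^k_{t,h}$ ($h\ge k\ge1$) and $V^k_{t,h}$ ($h\ge k\ge 2$) are defined by mutual induction: (1) if $h=k=1$ then $U^k_{t,h}=\langle\rangle$;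 (2) if $h>1$ and $k=1$ then $U^k_{t,h}=\langle U^k_{t,h-1}\rangle$; (3) if $h\ge k\ge2$ and $t=0$ then $U^k_{t,h}=V^k_{t,h}=\langle U^{k-1}_{t,h-1}\rangle$; (4) if $h\ge k\ge 2$ and $t\ge1$ then $V^k_{t,h}=V^k_{t-1,h}\cdot\langle U^{k-1}_{t,h-1}\rangle\cdot V^k_{t-1,h}$; (5) if $h=k\ge2$ and $t\ge1$ then $U^k_{t,h}=V^k_{t,h}$; (6) if $h>k\ge2$ and $t\ge1$ then $U^k_{t,h}=V^k_{t,h}\cdot\langle U^k_{t,h-1}\rangle\cdot V^k_{t,h}$. -}

module Defs where

open import Data.Bool.Base using (if_then_else_)
open import Data.Empty using (⊥-elim-irr)
open import Data.List.Base using (List; []; _∷_; _++_; [_]; filter; length)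
open import Data.List.Extrema.Nat using (max)
open import Data.List.Relation.Binary.Sublist.Heterogeneous.Core using (Sublist)
open import Data.Nat.Base using (ℕ; zero; suc; _+_; _≤_; _<_; z≤n; s≤s; s≤s⁻¹)
open import Data.Nat.ListAction using (sum)
open import Data.Nat.Properties using (_≟_; _<?_; <⇒≤; n≮n)
open import Data.Product.Base using (_×_)
open import Relation.Nullary.Decidable using (Dec; yes; no; does)

data Tree : Set where
  node : List Tree → Tree

⟨⟩ : Tree
⟨⟩ = node []

⟨_⟩ : Tree → Tree
⟨ T ⟩ = node [ T ]

infixr 5 _·_

_·_ : Tree → Tree → Tree
node Ss · node Ts = node (Ss ++ Ts)

mutual
  leaves : Tree → ℕ
  leaves (node [])       = 1
  leaves (node (T ∷ Ts)) = sum (leavesAll (T ∷ Ts))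

  leavesAll : List Tree → List ℕ
  leavesAll []       = []
  leavesAll (T ∷ Ts) = leaves T ∷ leavesAll Ts

mutual
  height : Tree → ℕ
  height (node [])       = 1
  height (node (T ∷ Ts)) = 1 + max 0 (heightAll (T ∷ Ts))

  heightAll : List Tree → List ℕ
  heightAll []       = []
  heightAll (T ∷ Ts) = height T ∷ heightAll Ts

multiplicity : ℕ → List ℕ → ℕ
multiplicity m ss = length (filter (m ≟_) ss)

-- The Strahler number of a non-leaf node from those of its children.
strahlerStep : List ℕ → ℕ
strahlerStep ss = if does (multiplicity m ss ≟ 1) then m else suc m
  where
  m : ℕ
  m = max 0 ss

mutual
  strahler : Tree → ℕ
  strahler (node [])       = 1
  strahler (node (T ∷ Ts)) = strahlerStep (strahlerAll (T ∷ Ts))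

  strahlerAll : List Tree → List ℕ
  strahlerAll []       = []
  strahlerAll (T ∷ Ts) = strahler T ∷ strahlerAll Ts

Small : ℕ → ℕ → Tree → Set
Small n h T = leaves T ≤ n × height T ≤ h

infix 4 _↪_

data _↪_ : Tree → Tree → Set where
  trivial : ∀ {T} → ⟨⟩ ↪ T
  nodes   : ∀ {Ss Ts} → Sublist _↪_ Ss Ts → node Ss ↪ node Ts

StrahlerUniversal : ℕ → ℕ → ℕ → Tree → Set
StrahlerUniversal k n h U = ∀ T → Small n h T → strahler T ≤ k → T ↪ U

-- U k t h and V k t h stand for Uᵏₜ,ₕ and Vᵏₜ,ₕ. The bounds on k and h are
-- irrelevant arguments, so the trees do not depend on how they are proved.
mutual
  U : (k t h : ℕ) → .(1 ≤ k) → .(k ≤ h) → Tree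
  U 1             t       1             _ _   = ⟨⟩
  U 1             t       (suc (suc h)) _ _   = ⟨ U 1 t (suc h) (s≤s z≤n) (s≤s z≤n) ⟩
  U (suc (suc k)) zero    (suc h)       _ k≤h = ⟨ U (suc k) zero h (s≤s z≤n) (s≤s⁻¹ k≤h) ⟩
  U (suc (suc k)) (suc t) (suc h)       _ k≤h =
    U⁺ (suc (suc k)) (suc t) (suc h) (s≤s (s≤s z≤n)) k≤h (suc (suc k) <? suc h)

  -- U k t h for k ≥ 2 and t ≥ 1, by cases on whether h = k or h > k.
  U⁺ : (k t h : ℕ) → .(2 ≤ k) → .(k ≤ h) → Dec (k < h) → Tree
  U⁺ k t h       2≤k k≤h (no _)    = V k t h 2≤k k≤h
  U⁺ k t (suc h) 2≤k k≤h (yes k<h) =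
    V k t (suc h) 2≤k k≤h · ⟨ U k t h (<⇒≤ 2≤k) (s≤s⁻¹ k<h) ⟩ · V k t (suc h) 2≤k k≤h

  V : (k t h : ℕ) → .(2 ≤ k) → .(k ≤ h) → Tree
  V 1             t       h       2≤1 _   = ⊥-elim-irr (n≮n 1 2≤1)
  V (suc (suc k)) zero    (suc h) _   k≤h = ⟨ U (suc k) zero h (s≤s z≤n) (s≤s⁻¹ k≤h) ⟩
  V (suc (suc k)) (suc t) (suc h) 2≤k k≤h =
    V (suc (suc k)) t (suc h) 2≤k k≤h
    · ⟨ U (suc k) (suc t) h (s≤s z≤n) (s≤s⁻¹ k≤h) ⟩
    · V (suc (suc k)) t (suc h) 2≤k k≤h

{-# OPTIONS --safe #-}
-- A forest with fewer than 2ᵗ⁺¹ leaves in total, all of whose trees have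
-- Strahler number < k, embeds in Vᵏₜ,ₕ by induction on t: some tree of the
-- forest has fewer than 2ᵗ leaves on either side of it, and that tree goes to
-- the middle child. A tree of Strahler number at most k has at most one child
-- of Strahler number k; that child goes to the middle child of Uᵏₜ,ₕ, and the
-- forests on both sides of it go to the two copies of Vᵏₜ,ₕ. If h = k, no
-- child can have Strahler number k, as Strahler numbers are bounded by heights.
module Submission where

open import Defs
open import Data.Bool.Base using (if_then_else_)
open import Data.List.Base using (List; []; _∷_; _++_; map; length)
open import Data.List.Extrema.Nat using (max; xs≤max; max≤v⁺)
open import Data.List.Properties using (map-++; filter-some; filter-accept; filter-reject)
open import Data.List.Relation.Binary.Sublist.Heterogeneous using (Sublist; minimum; []; _∷_)
open import Data.List.Relation.Binary.Sublist.Heterogeneous.Properties using (++⁺)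
open import Data.List.Relation.Unary.All as All using (All; []; _∷_)
open import Data.List.Relation.Unary.All.Properties using (++⁻; map⁺; map⁻; ¬Any⇒All¬)
open import Data.Nat.Base using (ℕ; zero; suc; _+_; _∸_; _^_; _≤_; _<_; z≤n; s≤s; s≤s⁻¹)
open import Data.Nat.ListAction using (sum)
open import Data.Nat.ListAction.Properties using (sum-++)
open import Data.Nat.Logarithm using (⌊log₂_⌋; ⌊log₂⌋-mono-≤; ⌊log₂[2^n]⌋≡n)
open import Data.Nat.Properties
open import Data.Product.Base using (_×_; _,_)
open import Data.Sum.Base using (_⊎_; inj₁; inj₂)
open import Function.Base using (_∘_)
open import Relation.Binary.PropositionalEquality using (_≡_; refl; sym; trans; cong; subst)
open import Relation.Nullary.Decidable using (Dec; yes; no; does)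
open import Relation.Nullary.Negation using (contradiction)

private
  variable
    S T X Y Z : Tree
    Ls Rs     : List Tree
    k h b     : ℕ

-- Leaves and heights of forests.

leavesAll≡map : ∀ Ts → leavesAll Ts ≡ map leaves Ts
leavesAll≡map []       = refl
leavesAll≡map (T ∷ Ts) = cong (leaves T ∷_) (leavesAll≡map Ts)

heightAll≡map : ∀ Ts → heightAll Ts ≡ map height Ts
heightAll≡map []       = refl
heightAll≡map (T ∷ Ts) = cong (height T ∷_) (heightAll≡map Ts)

strahlerAll≡map : ∀ Ts → strahlerAll Ts ≡ map strahler Ts
strahlerAll≡map []       = refl
strahlerAll≡map (T ∷ Ts) = cong (strahler T ∷_) (strahlerAll≡map Ts)

max-map-≤ : ∀ (f : Tree → ℕ) Ts {b} → max 0 (map f Ts) ≤ b → All ((_≤ b) ∘ f) Ts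
max-map-≤ f Ts m≤b = All.map (λ p → ≤-trans p m≤b) (map⁻ (xs≤max 0 (map f Ts)))

-- Unlike `leaves (node Ts)`, this is 0 on the empty forest and hence additive under `++`.
forestLeaves : List Tree → ℕ
forestLeaves Ts = sum (map leaves Ts)

forestLeaves≤leaves : ∀ Ts → forestLeaves Ts ≤ leaves (node Ts)
forestLeaves≤leaves []       = z≤n
forestLeaves≤leaves (T ∷ Ts) = ≤-reflexive (cong sum (sym (leavesAll≡map (T ∷ Ts))))

forestLeaves-++ : ∀ Ls Rs → forestLeaves (Ls ++ Rs) ≡ forestLeaves Ls + forestLeaves Rs
forestLeaves-++ Ls Rs = trans (cong sum (map-++ leaves Ls Rs)) (sum-++ (map leaves Ls) (map leaves Rs))

leaves<-all : ∀ Ts → forestLeaves Ts < b → All ((_< b) ∘ leaves) Ts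
leaves<-all []       _ = []
leaves<-all (T ∷ Ts) p = ≤-<-trans (m≤m+n _ _) p ∷ leaves<-all Ts (≤-<-trans (m≤n+m _ (leaves T)) p)

leaves>0 : ∀ T → 0 < leaves T
leaves>0 (node [])       = s≤s z≤n
leaves>0 (node (T ∷ Ts)) = ≤-trans (leaves>0 T) (m≤m+n _ _)

height>0 : ∀ T → 0 < height T
height>0 (node [])      = s≤s z≤n
height>0 (node (_ ∷ _)) = s≤s z≤n

children-height : ∀ Ts → height (node Ts) ≤ suc h → All ((_≤ h) ∘ height) Ts
children-height []       _ = []
children-height (T ∷ Ts) p rewrite heightAll≡map Ts = max-map-≤ height (T ∷ Ts) (s≤s⁻¹ p)

-- Strahler numbers.

if-cases : ∀ {P : Set} {x y : ℕ} (P? : Dec P) →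
  (P × (if does P? then x else y) ≡ x) ⊎ (if does P? then x else y) ≡ y
if-cases (yes p) = inj₁ (p , refl)
if-cases (no _)  = inj₂ refl

-- Going through `if-cases` allows matching on a variable decision instead of on the test inside
-- `strahlerStep`.
strahlerStep-cases : ∀ ss →
  (multiplicity (max 0 ss) ss ≡ 1 × strahlerStep ss ≡ max 0 ss) ⊎ strahlerStep ss ≡ suc (max 0 ss)
strahlerStep-cases ss = if-cases (multiplicity (max 0 ss) ss ≟ 1)

max≤strahlerStep : ∀ ss → max 0 ss ≤ strahlerStep ss
max≤strahlerStep ss with strahlerStep-cases ss
... | inj₁ (_ , eq) = ≤-reflexive (sym eq)
... | inj₂ eq       = ≤-trans (n≤1+n _) (≤-reflexive (sym eq))

strahlerStep≤1+max : ∀ ss → strahlerStep ss ≤ suc (max 0 ss)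
strahlerStep≤1+max ss with strahlerStep-cases ss
... | inj₁ (_ , eq) = ≤-trans (≤-reflexive eq) (n≤1+n _)
... | inj₂ eq       = ≤-reflexive eq

strahler>0 : ∀ T → 0 < strahler T
strahler>0 (node [])       = s≤s z≤n
strahler>0 (node (T ∷ Ts)) =
  ≤-trans (strahler>0 T) (≤-trans (All.head (xs≤max 0 ss)) (max≤strahlerStep ss))
  where ss = strahlerAll (T ∷ Ts)

-- The Strahler number of an inner node exceeds the maximum over its children by at most one, its
-- height by exactly one. The recursion is on the bound `h`, since the trees reached through
-- `All.map` are not visibly smaller.
strahler≤height : ∀ h T → height T ≤ h → strahler T ≤ h
strahler≤height zero    T               p = contradiction (≤-trans (height>0 T) p) λ()
strahler≤height (suc h) (node [])       p = s≤s z≤n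
strahler≤height (suc h) (node (T ∷ Ts)) p =
  ≤-trans (strahlerStep≤1+max (strahlerAll (T ∷ Ts))) (s≤s (max≤v⁺ z≤n
    (subst (All (_≤ h)) (sym (strahlerAll≡map (T ∷ Ts))) (map⁺ (All.map (λ {T} → strahler≤height h T) (children-height (T ∷ Ts) p))))))

-- Every leaf descends from some child, so a single leaf forces a path, and a sole child passes on
-- its Strahler number unchanged.
single-leaf-strahler : ∀ T → leaves T < 2 → strahler T ≡ 1
single-leaf-strahler (node [])           _ = refl
single-leaf-strahler (node (T ∷ []))     p
  rewrite single-leaf-strahler T (≤-<-trans (m≤m+n _ _) p) = refl
single-leaf-strahler (node (S ∷ T ∷ Ts)) p =
  contradiction p (≤⇒≯ (+-mono-≤ (leaves>0 S) (≤-trans (leaves>0 T) (m≤m+n _ _))))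

-- Splitting a forest around one of its trees.

data Split (L : List Tree → Set) (M : Tree → Set) (R : List Tree → Set) : List Tree → Set where
  empty : Split L M R []
  split : ∀ Ls T Rs → L Ls → M T → R Rs → Split L M R (Ls ++ T ∷ Rs)

StrahlerSplit : ℕ → List Tree → Set
StrahlerSplit k = Split (All ((_≤ k) ∘ strahler)) ((_≤ suc k) ∘ strahler) (All ((_≤ k) ∘ strahler))

multiplicity≡0⇒< : ∀ m ss → All (_≤ m) ss → multiplicity m ss ≡ 0 → All (_< m) ss
multiplicity≡0⇒< m ss ss≤m none =
  All.zipWith (λ (s≤m , m≢s) → ≤∧≢⇒< s≤m (m≢s ∘ sym)) (ss≤m , ¬Any⇒All¬ ss λ any →
    contradiction (subst (0 <_) none (filter-some (m ≟_) any)) λ())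

split-at-unique-max : ∀ {m} → m ≤ suc k → ∀ Ts → All (_≤ m) (map strahler Ts) →
  multiplicity m (map strahler Ts) ≡ 1 →
  StrahlerSplit k Ts
split-at-unique-max         m≤1+k []       _             ()
split-at-unique-max {m = m} m≤1+k (T ∷ Ts) (T≤m ∷ Ts≤m) unique with m ≟ strahler T
... | yes m≡T = split [] T Ts [] (≤-trans T≤m m≤1+k)
  (All.map (λ s<m → s≤s⁻¹ (≤-trans s<m m≤1+k)) (map⁻ (multiplicity≡0⇒< m (map strahler Ts) Ts≤m
    (suc-injective (trans (cong length (sym (filter-accept (m ≟_) m≡T))) unique)))))
... | no  m≢T with split-at-unique-max m≤1+k Ts Ts≤m
                     (trans (cong length (sym (filter-reject (m ≟_) m≢T))) unique)
-- Multiplicity 1 excludes an empty tail, but the type of the recursive result does not; `T` then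
-- serves as the middle tree.
...   | empty               = split [] T [] [] (≤-trans T≤m m≤1+k) []
...   | split Ls S Rs l s r = split (T ∷ Ls) S Rs
  (s≤s⁻¹ (≤-trans (≤∧≢⇒< T≤m (m≢T ∘ sym)) m≤1+k) ∷ l) s r

split-by-strahler : ∀ k Ts → strahler (node Ts) ≤ suc k →
  StrahlerSplit k Ts
split-by-strahler k []           _ = empty
split-by-strahler k Ts@(T ∷ Ts′) p = by-cases (strahlerStep-cases ss)
  where
  ss = map strahler Ts

  step≤1+k : strahlerStep ss ≤ suc k
  step≤1+k = subst (λ ss → strahlerStep ss ≤ suc k) (strahlerAll≡map Ts) p

  by-cases : (multiplicity (max 0 ss) ss ≡ 1 × strahlerStep ss ≡ max 0 ss) ⊎
    strahlerStep ss ≡ suc (max 0 ss) →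
    StrahlerSplit k Ts
  by-cases (inj₁ (unique , step≡)) =
    split-at-unique-max (subst (_≤ suc k) step≡ step≤1+k) Ts (xs≤max 0 ss) unique
  -- The step exceeds the maximum, so every child is at most `k` and any of them can be the middle
  -- tree; the first is chosen.
  by-cases (inj₂ step≡) with max-map-≤ strahler Ts (s≤s⁻¹ (subst (_≤ suc k) step≡ step≤1+k))
  ... | T≤k ∷ Ts≤k = split [] T Ts′ [] (m≤n⇒m≤1+n T≤k) Ts≤k

-- The left and right budgets are kept apart because only `a` shrinks. If the tail fits below `b`,
-- the first tree becomes the middle. Otherwise the tail has at least `b` leaves, so the first tree
-- has fewer than `a` and is charged to the left budget.
split-by-leaves : ∀ a b Ts → 0 < a → 0 < b → forestLeaves Ts < a + b →
  Split ((_< a) ∘ forestLeaves) ((_< a + b) ∘ leaves) ((_< b) ∘ forestLeaves) Ts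
split-by-leaves a b []       _   _   _ = empty
split-by-leaves a b (T ∷ Ts) 0<a 0<b p with forestLeaves Ts <? b
... | yes Ts<b = split [] T Ts 0<a (≤-<-trans (m≤m+n _ _) p) Ts<b
... | no  Ts≮b = extend (split-by-leaves (a ∸ leaves T) b Ts (m<n⇒0<n∸m T<a) 0<b
    (+-cancelˡ-< (leaves T) _ _ (subst (leaves T + forestLeaves Ts <_) a+b≡ p)))
  where
  T<a : leaves T < a
  T<a = +-cancelʳ-< b _ _ (≤-<-trans (+-monoʳ-≤ (leaves T) (≮⇒≥ Ts≮b)) p)

  a+b≡ : a + b ≡ leaves T + (a ∸ leaves T + b)
  a+b≡ = trans (cong (_+ b) (sym (m+[n∸m]≡n (<⇒≤ T<a)))) (+-assoc (leaves T) _ b)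

  extend : ∀ {Ts} →
    Split ((_< a ∸ leaves T) ∘ forestLeaves) ((_< a ∸ leaves T + b) ∘ leaves) ((_< b) ∘ forestLeaves) Ts →
    Split ((_< a) ∘ forestLeaves) ((_< a + b) ∘ leaves) ((_< b) ∘ forestLeaves) (T ∷ Ts)
  extend empty                 = split [] T [] 0<a (<-≤-trans T<a (m≤m+n a b)) 0<b
  extend (split Ls S Rs l s r) = split (T ∷ Ls) S Rs
    (subst (leaves T + forestLeaves Ls <_) (m+[n∸m]≡n (<⇒≤ T<a)) (+-monoʳ-< (leaves T) l))
    (<-≤-trans s (+-monoˡ-≤ b (m∸n≤m a (leaves T)))) r

forestLeaves-split : ∀ Ls T Rs → forestLeaves (Ls ++ T ∷ Rs) < b →
  forestLeaves Ls < b × leaves T < b × forestLeaves Rs < b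
forestLeaves-split Ls T Rs p =
    ≤-<-trans (m≤m+n _ _) q
  , ≤-<-trans (≤-trans (m≤m+n _ _) (m≤n+m _ (forestLeaves Ls))) q
  , ≤-<-trans (≤-trans (m≤n+m _ (leaves T)) (m≤n+m _ (forestLeaves Ls))) q
  where q = subst (_< _) (forestLeaves-++ Ls (T ∷ Rs)) p

-- Composing embeddings.

⟨⟩-mono : S ↪ T → ⟨ S ⟩ ↪ ⟨ T ⟩
⟨⟩-mono S↪T = nodes (S↪T ∷ [])

·-mono : ∀ {S S′ T T′} → S ↪ T → S′ ↪ T′ → S · S′ ↪ T · T′
·-mono {node _} {node _} {node _} {node _} p q = nodes (++⁺ (sublist p) (sublist q))
  where
  sublist : ∀ {Ss Ts} → node Ss ↪ node Ts → Sublist _↪_ Ss Ts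
  sublist trivial    = minimum _
  sublist (nodes ps) = ps

split-↪ : node Ls ↪ X → T ↪ Y → node Rs ↪ Z → node (Ls ++ T ∷ Rs) ↪ X · ⟨ Y ⟩ · Z
split-↪ l t r = ·-mono l (·-mono (⟨⟩-mono t) r)

-- Strahler number 1 means a path: splitting with `k = 0` leaves only side trees of Strahler number
-- 0, and there are none.
U¹-embeds : ∀ t h T → height T ≤ suc h → strahler T ≤ 1 →
  T ↪ U 1 t (suc h) (s≤s z≤n) (s≤s z≤n)
U¹-embeds t zero    (node [])       _       _ = trivial
U¹-embeds t zero    (node (T ∷ Ts)) height≤ _ =
  contradiction (≤-trans (height>0 T) (All.head (children-height (T ∷ Ts) height≤))) λ()
U¹-embeds t (suc h) (node Ts)       height≤ strahler≤
  with children-height Ts height≤ | split-by-strahler 0 Ts strahler≤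
... | _   | empty                            = trivial
... | _   | split (S ∷ _) _ _ (S≤0 ∷ _) _ _  = contradiction (≤-trans (strahler>0 S) S≤0) λ()
... | _   | split [] _ (S ∷ _) _ _ (S≤0 ∷ _) = contradiction (≤-trans (strahler>0 S) S≤0) λ()
... | T≤h | split [] T [] _ T≤1 _            = ⟨⟩-mono (U¹-embeds t h T (All.head T≤h) T≤1)

-- Embedding into `U` and `V`.

mutual
  -- The leaf bound is a strict power of two so that it halves exactly when `t` drops by one.
  U-embeds : ∀ k t h .(1≤k : 1 ≤ k) .(k≤h : k ≤ h) T →
    leaves T < 2 ^ suc t → height T ≤ h → strahler T ≤ k → T ↪ U k t h 1≤k k≤h
  U-embeds 1 t (suc h) _ _ T _ height≤ strahler≤ = U¹-embeds t h T height≤ strahler≤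
  U-embeds (suc (suc k)) zero (suc h) _ k≤h (node Ts) leaves< height≤ _ =
    V-embeds k zero h k≤h Ts forestLeaves< (children-height Ts height≤)
      -- At `t = 0` the trees `U` and `V` coincide, and fewer than two leaves force Strahler number
      -- 1.
      (All.map (λ {T} p → ≤-trans (≤-reflexive (single-leaf-strahler T p)) (s≤s z≤n))
        (leaves<-all Ts forestLeaves<))
    where forestLeaves< = ≤-<-trans (forestLeaves≤leaves Ts) leaves<
  U-embeds (suc (suc k)) (suc t) (suc h) _ k≤h T =
    U⁺-embeds k (suc t) h k≤h (suc (suc k) <? suc h) T

  -- The decision is an argument, as in `U⁺`, so that matching on it makes the target tree reduce.
  U⁺-embeds : ∀ k t h .(k≤h : suc (suc k) ≤ suc h) (k<h? : Dec (suc (suc k) < suc h)) T →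
    leaves T < 2 ^ suc t → height T ≤ suc h → strahler T ≤ suc (suc k) →
    T ↪ U⁺ (suc (suc k)) t (suc h) (s≤s (s≤s z≤n)) k≤h k<h?
  U⁺-embeds k t h k≤h (no k≮h) (node Ts) leaves< height≤ _ =
    V-embeds k t h k≤h Ts (≤-<-trans (forestLeaves≤leaves Ts) leaves<) height≤h
      (All.map (λ {T} p → ≤-trans (strahler≤height h T p) (s≤s⁻¹ (≮⇒≥ k≮h))) height≤h)
    where height≤h = children-height Ts height≤
  U⁺-embeds k t h k≤h (yes k<h) (node Ts) leaves< height≤ strahler≤
    with forestLeaves<  ← ≤-<-trans (forestLeaves≤leaves Ts) leaves<
       | height≤h       ← children-height Ts height≤
       | split-by-strahler (suc k) Ts strahler≤
  ... | empty = trivial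
  ... | split Ls T Rs l m r
    with Ls< , T< , Rs< ← forestLeaves-split Ls T Rs forestLeaves<
       | Ls≤h , T≤h ∷ Rs≤h ← ++⁻ Ls height≤h =
    split-↪ (V-embeds k t h k≤h Ls Ls< Ls≤h l)
            (U-embeds (suc (suc k)) t h _ _ T T< T≤h m)
            (V-embeds k t h k≤h Rs Rs< Rs≤h r)

  -- Height and Strahler number are bounded for each tree of the forest, not for `node Ts`, so the
  -- bounds pass to both side forests of a split.
  V-embeds : ∀ k t h .(k≤h : suc (suc k) ≤ suc h) Ts →
    forestLeaves Ts < 2 ^ suc t → All ((_≤ h) ∘ height) Ts → All ((_≤ suc k) ∘ strahler) Ts →
    node Ts ↪ V (suc (suc k)) t (suc h) (s≤s (s≤s z≤n)) k≤h
  V-embeds k zero h k≤h []           _  _ _ = trivial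
  V-embeds k zero h k≤h (T ∷ [])     p (T≤h ∷ _) (T≤k ∷ _) =
    ⟨⟩-mono (U-embeds (suc k) zero h _ _ T (≤-<-trans (m≤m+n _ _) p) T≤h T≤k)
  V-embeds k zero h k≤h (S ∷ T ∷ Ts) p _ _ =
    contradiction p (≤⇒≯ (+-mono-≤ (leaves>0 S) (≤-trans (leaves>0 T) (m≤m+n _ _))))
  V-embeds k (suc t) h k≤h Ts p height≤h strahler≤k
    -- `2 ^ suc (suc t)` unfolds to two copies of `2 ^ suc t`, up to a `+ 0`; each is the leaf bound
    -- for one copy of `V` at `t`.
    with split-by-leaves (2 ^ suc t) (2 ^ suc t) Ts (m^n>0 2 (suc t)) (m^n>0 2 (suc t))
           (subst (λ b → forestLeaves Ts < 2 ^ suc t + b) (+-identityʳ _) p)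
  ... | empty = trivial
  ... | split Ls T Rs l m r
    with Ls≤h , T≤h ∷ Rs≤h ← ++⁻ Ls height≤h
       | Ls≤k , T≤k ∷ Rs≤k ← ++⁻ Ls strahler≤k =
    split-↪ (V-embeds k t h k≤h Ls l Ls≤h Ls≤k)
            -- The middle tree may hold almost all the leaves, so it keeps `suc t`; its Strahler and
            -- height indices drop instead.
            (U-embeds (suc k) (suc t) h _ _ T
              (subst (λ b → leaves T < 2 ^ suc t + b) (sym (+-identityʳ _)) m) T≤h T≤k)
            (V-embeds k t h k≤h Rs r Rs≤h Rs≤k)

-- Otherwise monotonicity of the logarithm would give `suc ⌊log₂ n ⌋ ≤ ⌊log₂ n ⌋`.
n<2^[1+⌊log₂n⌋] : ∀ n → n < 2 ^ suc ⌊log₂ n ⌋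
n<2^[1+⌊log₂n⌋] n = ≰⇒> λ 2^[1+l]≤n →
  n≮n ⌊log₂ n ⌋ (subst (_≤ ⌊log₂ n ⌋) (⌊log₂[2^n]⌋≡n _) (⌊log₂⌋-mono-≤ 2^[1+l]≤n))

lemma16 : (n k h : ℕ) → 1 ≤ n → (1≤k : 1 ≤ k) → (k≤h : k ≤ h) →
    StrahlerUniversal k n h (U k ⌊log₂ n ⌋ h 1≤k k≤h)
lemma16 n k h _ 1≤k k≤h T (leaves≤n , height≤h) strahler≤k =
  U-embeds k ⌊log₂ n ⌋ h 1≤k k≤h T
    (≤-<-trans leaves≤n (n<2^[1+⌊log₂n⌋] n)) height≤h strahler≤k
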